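{- Let $n\ge2$. There is a unimodular triangulation of $\Delta^n$ whose simplicial complex is combinatorially isomorphic to a triple cone over the bipermutahedral fan $\Sigma_{n,n}$; that is, isomorphic to the simplicial complex with vertex set $\{\text{rays of }\Sigma_{n,n}\}\sqcup\{a,b,c\}$ whose faces are the sets $R\cup A$ with $R$ the set of rays of a cone of $\Sigma_{n,n}$ and $A\subseteq\{a,b,c\}$.
   Context: Let $\mathsf{e},\mathsf{f},\mathsf{g}$ be the standard basis of $\mathbb{R}^3$, $\Delta=\mathrm{conv}(\mathsf{e},\mathsf{f},\mathsf{g})$, and $\Delta^n=\Delta\times\cdots\times\Delta\subset\mathbb{R}^{3\times n}$ ($n$ factors). A triangulation of $\Delta^n$ is unimodular if all its simplices have vertices in $\mathbb{Z}^{3n}$ and each full-dimensional simplex has edge vectors from a vertex forming a basis of the lattice $\mathbb{Z}^{3n}$ intersected with the linear span parallel to the affine hull of $\Delta^n$. Let $N_n=\mathbb{R}^n/\mathbb{R}(1,\dots,1)$; for $S\subseteq[n]$ let $\mathsf{e}_S,\mathsf{f}_S$ be the images in the first, second factor of $N_n\times N_n$ of the indicator vector of $S$. A bipermutation of $[n]$ is a sequence $b_1|\cdots|b_{2n-1}$ of elements of $[n]$ in which one element appears exactly once and every other element exactly twice. The bipermutahedral fan $\Sigma_{n,n}$ is the complete simplicial fan in $N_n\times N_n$ whose maximal cones are $\mathrm{cone}\{\mathsf{e}_{\{b_1,\dots,b_m\}}+\mathsf{f}_{\{b_{m+1},\dots,b_{2n-1}\}}:1\le m\le 2n-2\}$ for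 the bipermutations, together with all their faces.
   Formalization: Points of Δ^n and the convex coefficients are rational instead of real: the simplices are shown to cover, and to meet along common faces at, the rational points of Δ^n; the scalars comparing rays are rational too. -}

module Defs where

open import Data.Nat as ℕ using (ℕ; zero; suc; _∸_)
open import Data.Bool using (Bool; true; false; _∧_; _∨_; if_then_else_)
open import Data.Fin as Fin using (Fin; toℕ)
open import Data.Integer as ℤ using (ℤ)
open import Data.Rational as ℚ using (ℚ; 0ℚ; 1ℚ)
open import Data.Product using (Σ; _×_; ∃; _,_)
open import Data.Unit using (⊤)
open import Relation.Nullary using (¬_)
open import Relation.Nullary.Decidable using (⌊_⌋)
open import Relation.Binary.PropositionalEquality using (_≡_; _≢_)

sumℕ : ∀ {k} → (Fin k → ℕ) → ℕ
sumℕ {zero}  f = 0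
sumℕ {suc k} f = f Fin.zero ℕ.+ sumℕ (λ t → f (Fin.suc t))

sumℤ : ∀ {k} → (Fin k → ℤ) → ℤ
sumℤ {zero}  f = ℤ.0ℤ
sumℤ {suc k} f = f Fin.zero ℤ.+ sumℤ (λ t → f (Fin.suc t))

sumℚ : ∀ {k} → (Fin k → ℚ) → ℚ
sumℚ {zero}  f = 0ℚ
sumℚ {suc k} f = f Fin.zero ℚ.+ sumℚ (λ t → f (Fin.suc t))

anyFin : ∀ {k} → (Fin k → Bool) → Bool
anyFin {zero}  f = false
anyFin {suc k} f = f Fin.zero ∨ anyFin (λ t → f (Fin.suc t))

toℚ : ℤ → ℚ
toℚ z = z ℚ./ 1

Word : ℕ → Set
Word n = Fin (2 ℕ.* n ∸ 1) → Fin n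

count : ∀ {n} → Word n → Fin n → ℕ
count b j = sumℕ (λ k → if ⌊ b k Fin.≟ j ⌋ then 1 else 0)

IsBiperm : ∀ {n} → Word n → Set
IsBiperm {n} b = Σ (Fin n) λ i → count b i ≡ 1 × (∀ j → j ≢ i → count b j ≡ 2)

Biperm : ℕ → Set
Biperm n = Σ (Word n) IsBiperm

-- Rays of the bipermutahedral fan Σ_{n,n}.
-- For a bipermutation b and an index m : Fin (2n-2) (standing for
-- m' = toℕ m + 1 ∈ {1,…,2n-2}) the generator is e_S + f_T with
-- S = {b_1,…,b_{m'}}, T = {b_{m'+1},…,b_{2n-1}}.
-- Positions are 0-based here: position k belongs to S iff toℕ k ≤ toℕ m.

inS : ∀ {n} → Word n → Fin (2 ℕ.* n ∸ 2) → Fin n → Bool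
inS b m i = anyFin (λ k → (toℕ k ℕ.≤ᵇ toℕ m) ∧ ⌊ b k Fin.≟ i ⌋)

inT : ∀ {n} → Word n → Fin (2 ℕ.* n ∸ 2) → Fin n → Bool
inT b m i = anyFin (λ k → (suc (toℕ m) ℕ.≤ᵇ toℕ k) ∧ ⌊ b k Fin.≟ i ⌋)

ind : Bool → ℚ
ind true  = 1ℚ
ind false = 0ℚ

-- Two generators e_S+f_T, e_S'+f_T' (vectors of ℝ^n × ℝ^n taken modulo
-- ℝ(1,…,1) in each factor, i.e. in N_n × N_n) span the same ray iff
-- (1_S,1_T) = λ (1_S',1_T') + (c·1, d·1) for some λ > 0 and constants c, d.
SameRay : ∀ {n} → (Fin n → Bool) × (Fin n → Bool) → (Fin n → Bool) × (Fin n → Bool) → Set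
SameRay {n} (S , T) (S' , T') =
  Σ ℚ λ l → Σ ℚ λ c → Σ ℚ λ d →
    (0ℚ ℚ.< l) ×
    (∀ i → ind (S i) ≡ l ℚ.* ind (S' i) ℚ.+ c) ×
    (∀ i → ind (T i) ≡ l ℚ.* ind (T' i) ℚ.+ d)

gen : ∀ {n} → Biperm n → Fin (2 ℕ.* n ∸ 2) → (Fin n → Bool) × (Fin n → Bool)
gen (b , _) m = inS b m , inT b m

-- Geometry of Δ^n ⊂ ℝ^{3n}. Points of ℝ^{3n} are indexed by (i , j),
-- i : Fin n the factor, j : Fin 3 the coordinate (e, f, g) in that factor.

ZVec : ℕ → Set
ZVec n = Fin n → Fin 3 → ℤ

QVec : ℕ → Set
QVec n = Fin n → Fin 3 → ℚ

_≈ᶻ_ : ∀ {n} → ZVec n → ZVec n → Set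
u ≈ᶻ v = ∀ i j → u i j ≡ v i j

InDelta : ∀ {n} → QVec n → Set
InDelta x = (∀ i j → 0ℚ ℚ.≤ x i j) × (∀ i → sumℚ (x i) ≡ 1ℚ)

InConvOn : ∀ {n k} → (Fin k → ZVec n) → (Fin k → Set) → QVec n → Set
InConvOn {n} {k} p P x =
  Σ (Fin k → ℚ) λ c →
    (∀ t → 0ℚ ℚ.≤ c t) ×
    (∀ t → c t ≢ 0ℚ → P t) ×
    (sumℚ c ≡ 1ℚ) ×
    (∀ i j → x i j ≡ sumℚ (λ t → c t ℚ.* toℚ (p t i j)))

InConv : ∀ {n k} → (Fin k → ZVec n) → QVec n → Set
InConv p x = InConvOn p (λ _ → ⊤) x

InConvCommon : ∀ {n k l} → (Fin k → ZVec n) → (Fin l → ZVec n) → QVec n → Set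
InConvCommon {l = l} p q x = InConvOn p (λ t → Σ (Fin l) λ s → p t ≈ᶻ q s) x

-- The lattice ℤ^{3n} ∩ (linear space parallel to aff Δ^n)
InLattice : ∀ {n} → ZVec n → Set
InLattice z = ∀ i → sumℤ (z i) ≡ ℤ.0ℤ

Unimodular : ∀ {n d} → (Fin (suc d) → ZVec n) → Set
Unimodular {n} {d} p =
  (∀ t → InLattice (edge t)) ×
  (∀ z → InLattice z → Σ (Fin d → ℤ) λ c → ∀ i j → z i j ≡ sumℤ (λ t → c t ℤ.* edge t i j)) ×
  (∀ (c : Fin d → ℤ) → (∀ i j → sumℤ (λ t → c t ℤ.* edge t i j) ≡ ℤ.0ℤ) → ∀ t → c t ≡ ℤ.0ℤ)
  where
  edge : Fin d → ZVec n
  edge t i j = p (Fin.suc t) i j ℤ.- p Fin.zero i j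

IsUnimodularTriangulation : ∀ {n k} (I : Set) → (I → Fin (suc k) → ZVec n) → Set
IsUnimodularTriangulation {n} I σ =
  (∀ a x → InConv (σ a) x → InDelta x) ×
  (∀ x → InDelta x → Σ I λ a → InConv (σ a) x) ×
  (∀ a a' x → InConv (σ a) x → InConv (σ a') x → InConvCommon (σ a) (σ a') x) ×
  (∀ a → Unimodular (σ a))

-- The simplex attached to a maximal face R_b ∪ {a,b,c} of the triple cone,
-- given a vertex map: ψ on the three cone points, φ on the rays.

coneSimplex : ∀ {n} → (Fin 3 → ZVec n) → (Biperm n → Fin (2 ℕ.* n ∸ 2) → ZVec n)
            → Biperm n → Fin (3 ℕ.+ (2 ℕ.* n ∸ 2)) → ZVec n
coneSimplex ψ φ B Fin.zero = ψ Fin.zero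
coneSimplex ψ φ B (Fin.suc Fin.zero) = ψ (Fin.suc Fin.zero)
coneSimplex ψ φ B (Fin.suc (Fin.suc Fin.zero)) = ψ (Fin.suc (Fin.suc Fin.zero))
coneSimplex ψ φ B (Fin.suc (Fin.suc (Fin.suc m))) = φ B m

-- The vertex map (ψ, φ) is a bijection from {rays of Σ_{n,n}} ⊔ {a,b,c}
-- onto its image: φ is well defined on rays and injective on rays,
-- ψ is injective, and the two images are disjoint.
IsVertexEmbedding : ∀ {n} → (Fin 3 → ZVec n) → (Biperm n → Fin (2 ℕ.* n ∸ 2) → ZVec n) → Set
IsVertexEmbedding {n} ψ φ =
  (∀ u v → ψ u ≈ᶻ ψ v → u ≡ v) ×
  (∀ u B m → ¬ (ψ u ≈ᶻ φ B m)) ×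
  (∀ B m B' m' → SameRay (gen B m) (gen B' m') → φ B m ≈ᶻ φ B' m') ×
  (∀ B m B' m' → φ B m ≈ᶻ φ B' m' → SameRay (gen B m) (gen B' m'))

{-# OPTIONS --safe #-}
-- A vertex of Δⁿ is a labelling [n] → {e,f,g}.  Send the ray e_S + f_T to the
-- labelling that is e off T, f off S and g on S ∩ T, and the cone points to the
-- constant labellings.  Reading a bipermutation from left to right gives a path
-- from fⁿ to eⁿ on which the letter i changes from f to g at its first
-- occurrence and from g to e at its last one (directly from f to e if it occurs
-- once); the simplex is spanned by this path and gⁿ.
--
-- For a combination with weight c_m on the m-th path vertex, the f-coordinate in
-- factor i is the partial sum of c up to the first occurrence of i, and r minus
-- the e-coordinate is the partial sum up to the last one, where r = 1 − (weight
-- of gⁿ).  The letter occurring once forces r = max_i (eᵢ + fᵢ).  Hence sorting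
-- the numbers fᵢ and r − eᵢ of a given point yields a simplex containing it, the
-- vertices of positive weight are determined by the point, and the same formulas
-- over ℤ show unimodularity.
module Submission where

open import Defs
open import Algebra.Bundles using (CommutativeRing)
import Algebra.Properties.AbelianGroup as AbelianGroupProperties
open import Data.Bool using (Bool; true; false; not; if_then_else_; _∧_)
import Data.Bool.Properties as Boolₚ
open import Data.Fin as Fin
  using (Fin; zero; suc; toℕ; fromℕ; punchIn; punchOut; splitAt; _↑ˡ_; _↑ʳ_)
open import Data.Fin.Patterns
open import Data.Fin.Permutation as Perm using (Permutation′; _⟨$⟩ʳ_; _⟨$⟩ˡ_)
import Data.Fin.Properties as Finₚ
open import Data.Integer as ℤ using (ℤ)
import Data.Integer.Properties as ℤₚ
import Data.Nat as ℕ
open import Data.Nat using (ℕ; zero; suc; _≤_; _<_; _∸_; z≤n; s≤s)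
import Data.Nat.Properties as ℕₚ
open import Data.Product using (Σ; ∃; ∃₂; _×_; _,_; proj₁; proj₂)
open import Data.Rational as ℚ using (ℚ; 0ℚ; 1ℚ)
import Data.Rational.Properties as ℚₚ
open import Data.Rational.Solver using (module +-*-Solver)
open import Data.Sum as Sum using (_⊎_; inj₁; inj₂; [_,_]′)
open import Data.Unit using (tt)
import Data.Vec.Functional as Vector
open import Function using (_∘_; const; id)
open import Function.Bundles using (mk⇔; Equivalence)
open import Relation.Binary.Definitions using (tri<; tri≈; tri>)
open import Relation.Binary.PropositionalEquality as ≡
  using (_≡_; _≢_; refl; sym; trans; cong; cong₂; subst; subst₂; module ≡-Reasoning)
open import Relation.Nullary using (¬_; Dec; yes; no; contradiction)
open import Relation.Nullary.Decidable using (⌊_⌋)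
open import Algebra.Properties.CommutativeMonoid.Sum ℕₚ.+-0-commutativeMonoid
  using () renaming (sum to ∑ℕ; sum-permute to ∑ℕ-permute)

-- Labellings and partial sums

-- The label of i in the image of the ray e_S + f_T, where s says i ∈ S and u
-- says i ∉ T.
pick : (s u : Bool) → Fin 3
pick s     true  = 0F
pick false false = 1F
pick true  false = 2F

-- The comparisons are strict, so step 0 is the constant labelling f and step `K` would be the
-- constant labelling e.
pathLabel : ∀ {n K} → (first last : Fin n → Fin K) → ℕ → Fin n → Fin 3
pathLabel first last m i = pick (toℕ (first i) ℕ.<ᵇ m) (toℕ (last i) ℕ.<ᵇ m)

-- Same order as in `coneSimplex`: gⁿ, eⁿ, then the path, whose step 0 is the third cone point fⁿ.
-- Thus eⁿ, the end of the path, stands ahead of it.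
simplexLabel : ∀ {n K} → (first last : Fin n → Fin K) → Fin (2 ℕ.+ K) → Fin n → Fin 3
simplexLabel first last 0F            i = 2F
simplexLabel first last 1F            i = 0F
simplexLabel first last (suc (suc m)) i = pathLabel first last (toℕ m) i

<ᵇ-antitone : ∀ {a b} c → a ≤ b → (b ℕ.<ᵇ c) ≡ true → (a ℕ.<ᵇ c) ≡ true
<ᵇ-antitone {zero}  {zero}  (suc c) p q = refl
<ᵇ-antitone {zero}  {suc b} (suc c) p q = refl
<ᵇ-antitone {suc a} {suc b} (suc c) (s≤s p) q = <ᵇ-antitone c p q

pick-e : ∀ s u → ⌊ pick s u Fin.≟ 0F ⌋ ≡ u
pick-e s     true  = refl
pick-e true  false = refl
pick-e false false = refl

pick-f : ∀ s u → (u ≡ true → s ≡ true) → ⌊ pick s u Fin.≟ 1F ⌋ ≡ not s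
pick-f true  true  h = refl
pick-f false true  h = contradiction (h refl) λ ()
pick-f true  false h = refl
pick-f false false h = refl

module PartialSums {c ℓ} (R : CommutativeRing c ℓ) where
  open CommutativeRing R
    hiding (zero; refl) renaming (sym to ≈-sym; trans to ≈-trans)
  open import Algebra.Properties.Semiring.Sum semiring
    using (sum-cong-≋; sum-replicate-zero; ∑-comm; *-distribˡ-sum; *-distribʳ-sum)
  open import Algebra.Properties.Semiring.Sum semiring public using (sum)
  open import Algebra.Properties.AbelianGroup +-abelianGroup
    using (xyx⁻¹≈y; //-rightDividesˡ)
    renaming (∙-cancelˡ to +-cancelˡ; ∙-cancelʳ to +-cancelʳ)
  open import Algebra.Properties.CommutativeSemigroup +-commutativeSemigroup
    using (x∙yz≈y∙xz)
  open import Relation.Binary.Reasoning.Setoid setoid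

  𝟙 : Bool → Carrier
  𝟙 b = if b then 1# else 0#

  prefix : ∀ {k} → (Fin k → Carrier) → Fin k → Carrier
  prefix x zero    = x zero
  prefix x (suc k) = x zero + prefix (x ∘ suc) k

  sum-cong : ∀ {k} {x y : Fin k → Carrier} → (∀ t → x t ≈ y t) → sum x ≈ sum y
  sum-cong = sum-cong-≋

  sum-zero : ∀ {k} (x : Fin k → Carrier) → (∀ t → x t ≈ 0#) → sum x ≈ 0#
  sum-zero {k} x h = ≈-trans (sum-cong h) (sum-replicate-zero k)

  sum-cong-𝟙 : ∀ {k} (x : Fin k → Carrier) {f g : Fin k → Bool} → (∀ m → f m ≡ g m) →
    sum (λ m → x m * 𝟙 (f m)) ≈ sum (λ m → x m * 𝟙 (g m))
  sum-cong-𝟙 x h = sum-cong (λ m → *-congˡ (reflexive (≡.cong 𝟙 (h m))))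

  -- Exchange of summation. Used with `s` equal to 0 for edge vectors and to 1 for vertices of Δⁿ.
  sum-combination : ∀ {k l} (x : Fin k → Carrier) (v : Fin k → Fin l → Carrier) s →
    (∀ t → sum (v t) ≈ s) → sum (λ j → sum (λ t → x t * v t j)) ≈ sum x * s
  sum-combination {k} x v s h = begin
    sum (λ j → sum (λ t → x t * v t j))  ≈⟨ ∑-comm (λ j t → x t * v t j) ⟩
    sum (λ t → sum (λ j → x t * v t j))
      ≈⟨ sum-cong (λ t → ≈-trans (≈-sym (*-distribˡ-sum (x t) (v t))) (*-congˡ (h t))) ⟩
    sum (λ t → x t * s)                  ≈⟨ *-distribʳ-sum {k} s x ⟨
    sum x * s ∎

  -- Allows the g-coordinate to be ignored once coordinate sums are known.
  third-determined : (u v : Fin 3 → Carrier) → sum u ≈ sum v → u 0F ≈ v 0F → u 1F ≈ v 1F →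
    ∀ j → u j ≈ v j
  third-determined u v h e f 0F = e
  third-determined u v h e f 1F = f
  third-determined u v h e f 2F = +-cancelʳ _ _ _ (+-cancelˡ _ _ _ (+-cancelˡ _ _ _ (≈-trans h
    (≈-sym (+-cong e (+-congʳ f))))))

  sum-upto : ∀ {k} (x : Fin k → Carrier) p →
    sum (λ m → x m * 𝟙 (not (toℕ p ℕ.<ᵇ toℕ m))) ≈ prefix x p
  sum-upto {suc k} x zero = begin
    x zero * 1# + sum (λ m → x (suc m) * 0#)
      ≈⟨ +-cong (*-identityʳ _) (sum-zero {k} _ (λ m → zeroʳ _)) ⟩
    x zero + 0#  ≈⟨ +-identityʳ _ ⟩
    x zero ∎
  sum-upto x (suc p) = +-cong (*-identityʳ _) (sum-upto (x ∘ suc) p)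

  sum-after : ∀ {k} (x : Fin k → Carrier) p →
    prefix x p + sum (λ m → x m * 𝟙 (toℕ p ℕ.<ᵇ toℕ m)) ≈ sum x
  sum-after {suc k} x zero = +-congˡ (begin
    x zero * 0# + sum (λ m → x (suc m) * 1#)
      ≈⟨ +-cong (zeroʳ _) (sum-cong {k} (λ m → *-identityʳ _)) ⟩
    0# + sum (x ∘ suc)  ≈⟨ +-identityˡ _ ⟩
    sum (x ∘ suc) ∎)
  sum-after x (suc p) = begin
    x zero + prefix (x ∘ suc) p + (x zero * 0# + s)
      ≈⟨ +-congˡ (≈-trans (+-congʳ (zeroʳ _)) (+-identityˡ _)) ⟩
    x zero + prefix (x ∘ suc) p + s  ≈⟨ +-assoc _ _ _ ⟩
    x zero + (prefix (x ∘ suc) p + s)  ≈⟨ +-congˡ (sum-after (x ∘ suc) p) ⟩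
    x zero + sum (x ∘ suc) ∎
    where s = sum (λ m → x (suc m) * 𝟙 (toℕ p ℕ.<ᵇ toℕ m))

  prefix-last : ∀ {k} (x : Fin (suc k) → Carrier) → prefix x (fromℕ k) ≈ sum x
  prefix-last {zero}  x = ≈-sym (+-identityʳ _)
  prefix-last {suc k} x = +-congˡ (prefix-last (x ∘ suc))

  -- Consecutive differences, where `a` is the value preceding the sequence; with `a` zero this
  -- inverts `prefix`.
  diff : ∀ {k} → Carrier → (Fin k → Carrier) → Fin k → Carrier
  diff a w zero    = w zero - a
  diff a w (suc k) = diff (w zero) (w ∘ suc) k

  prefix-diff : ∀ {k} a (w : Fin k → Carrier) p → a + prefix (diff a w) p ≈ w p
  prefix-diff a w zero = begin
    a + (w zero - a)  ≈⟨ +-assoc _ _ _ ⟨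
    a + w zero - a    ≈⟨ xyx⁻¹≈y a (w zero) ⟩
    w zero ∎
  prefix-diff a w (suc p) = begin
    a + (w zero - a + d)  ≈⟨ +-assoc _ _ _ ⟨
    a + (w zero - a) + d  ≈⟨ +-congʳ (prefix-diff a w zero) ⟩
    w zero + d            ≈⟨ prefix-diff (w zero) (w ∘ suc) p ⟩
    w (suc p) ∎
    where d = prefix (diff (w zero) (w ∘ suc)) p

  prefix-zero : ∀ {k} (x : Fin k → Carrier) → (∀ p → prefix x p ≈ 0#) → ∀ p → x p ≈ 0#
  prefix-zero x h zero    = h zero
  prefix-zero x h (suc p) = prefix-zero (x ∘ suc) (λ q → begin
    prefix (x ∘ suc) q           ≈⟨ +-identityˡ _ ⟨
    0# + prefix (x ∘ suc) q      ≈⟨ +-congʳ (h zero) ⟨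
    x zero + prefix (x ∘ suc) q  ≈⟨ h (suc q) ⟩
    0# ∎) p

  -- Coordinates of a combination of the vertices of a simplex.  The first
  -- coefficient belongs to the vertex gⁿ, the second to eⁿ.
  coordinate : ∀ {n K} (first last : Fin n → Fin K) → (Fin (2 ℕ.+ K) → Carrier) →
    Fin n → Fin 3 → Carrier
  coordinate first last x i j = sum (λ t → x t * 𝟙 ⌊ simplexLabel first last t i Fin.≟ j ⌋)

  module _ {n K} (first last : Fin n → Fin K) (x : Fin (2 ℕ.+ K) → Carrier) where
    private
      y : Fin K → Carrier
      y m = x (suc (suc m))

    -- Factor i has label e exactly at the steps after `last i` and at eⁿ. The prefix supplies the
    -- remaining path coefficients, so the total no longer depends on i.
    coordinate-e : ∀ i →
      prefix y (last i) + coordinate first last x i 0F ≈ x 1F + sum y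
    coordinate-e i = begin
      prefix y (last i) + (x 0F * 0# +
        (x 1F * 1# + sum (λ m → y m * 𝟙 ⌊ pathLabel first last (toℕ m) i Fin.≟ 0F ⌋)))
        ≈⟨ +-congˡ (≈-trans (+-congʳ (zeroʳ _)) (+-identityˡ _)) ⟩
      prefix y (last i) + (x 1F * 1# + sum (λ m → y m * 𝟙 ⌊ pathLabel first last (toℕ m) i Fin.≟ 0F ⌋))
        ≈⟨ x∙yz≈y∙xz _ _ _ ⟩
      x 1F * 1# + (prefix y (last i) + sum (λ m → y m * 𝟙 ⌊ pathLabel first last (toℕ m) i Fin.≟ 0F ⌋))
        ≈⟨ +-cong (*-identityʳ _) (+-congˡ (sum-cong-𝟙 y (λ m →
             pick-e (toℕ (first i) ℕ.<ᵇ toℕ m) (toℕ (last i) ℕ.<ᵇ toℕ m)))) ⟩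
      x 1F + (prefix y (last i) + sum (λ m → y m * 𝟙 (toℕ (last i) ℕ.<ᵇ toℕ m)))
        ≈⟨ +-congˡ (sum-after y (last i)) ⟩
      x 1F + sum y ∎

    -- Factor i keeps label f up to and including step `first i`; neither gⁿ nor eⁿ contributes.
    coordinate-f : ∀ i → first i Fin.≤ last i →
      coordinate first last x i 1F ≈ prefix y (first i)
    coordinate-f i le = begin
      x 0F * 0# + (x 1F * 0# + sum (λ m → y m * 𝟙 ⌊ pathLabel first last (toℕ m) i Fin.≟ 1F ⌋))
        ≈⟨ ≈-trans (+-congʳ (zeroʳ _)) (+-identityˡ _) ⟩
      x 1F * 0# + sum (λ m → y m * 𝟙 ⌊ pathLabel first last (toℕ m) i Fin.≟ 1F ⌋)
        ≈⟨ ≈-trans (+-congʳ (zeroʳ _)) (+-identityˡ _) ⟩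
      sum (λ m → y m * 𝟙 ⌊ pathLabel first last (toℕ m) i Fin.≟ 1F ⌋)
        ≈⟨ sum-cong-𝟙 y (λ m →
             pick-f (toℕ (first i) ℕ.<ᵇ toℕ m) _ (<ᵇ-antitone (toℕ m) le)) ⟩
      sum (λ m → y m * 𝟙 (not (toℕ (first i) ℕ.<ᵇ toℕ m)))
        ≈⟨ sum-upto y (first i) ⟩
      prefix y (first i) ∎

  -- Prescribes weight γ on gⁿ, total weight r on all other vertices and partial sums `w` along the
  -- path; eⁿ receives what is left of r.
  solution : ∀ {K} → Carrier → Carrier → (Fin K → Carrier) → Fin (2 ℕ.+ K) → Carrier
  solution γ r w 0F            = γ
  solution γ r w 1F            = r - sum (diff 0# w)
  solution γ r w (suc (suc m)) = diff 0# w m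

  module _ {n K} (first last : Fin n → Fin K) (γ r : Carrier) (w : Fin K → Carrier)
           (α β : Fin n → Carrier) where
    private
      prefix-solution : ∀ p → prefix (diff 0# w) p ≈ w p
      prefix-solution p = ≈-trans (≈-sym (+-identityˡ _)) (prefix-diff 0# w p)

    solution-e : (∀ i → w (last i) ≈ r - α i) →
      ∀ i → coordinate first last (solution γ r w) i 0F ≈ α i
    solution-e h i = +-cancelˡ (r - α i) _ _ (begin
      r - α i + x                          ≈⟨ +-congʳ (≈-trans (prefix-solution (last i)) (h i)) ⟨
      prefix (diff 0# w) (last i) + x      ≈⟨ coordinate-e first last (solution γ r w) i ⟩
      r - sum (diff 0# w) + sum (diff 0# w)  ≈⟨ //-rightDividesˡ _ r ⟩
      r                                    ≈⟨ //-rightDividesˡ (α i) r ⟨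
      r - α i + α i ∎)
      where x = coordinate first last (solution γ r w) i 0F

    solution-f : (∀ i → w (first i) ≈ β i) → (∀ i → first i Fin.≤ last i) →
      ∀ i → coordinate first last (solution γ r w) i 1F ≈ β i
    solution-f h le i = ≈-trans (coordinate-f first last (solution γ r w) i (le i))
      (≈-trans (prefix-solution (first i)) (h i))

-- Positions of the letters in a bipermutation

⌊⌋-true : ∀ {P : Set} (P? : Dec P) → P → ⌊ P? ⌋ ≡ true
⌊⌋-true (yes _) p = refl
⌊⌋-true (no ¬p) p = contradiction p ¬p

⌊⌋-true⁻ : ∀ {P : Set} (P? : Dec P) → ⌊ P? ⌋ ≡ true → P
⌊⌋-true⁻ (yes p) _ = p

<ᵇ-true : ∀ {m n} → m < n → (m ℕ.<ᵇ n) ≡ true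
<ᵇ-true = Equivalence.to Boolₚ.T-≡ ∘ ℕₚ.<⇒<ᵇ

<ᵇ-true⁻ : ∀ {m n} → (m ℕ.<ᵇ n) ≡ true → m < n
<ᵇ-true⁻ = ℕₚ.<ᵇ⇒< _ _ ∘ Equivalence.from Boolₚ.T-≡

≤ᵇ-true : ∀ {m n} → m ≤ n → (m ℕ.≤ᵇ n) ≡ true
≤ᵇ-true = Equivalence.to Boolₚ.T-≡ ∘ ℕₚ.≤⇒≤ᵇ

≤ᵇ-true⁻ : ∀ {m n} → (m ℕ.≤ᵇ n) ≡ true → m ≤ n
≤ᵇ-true⁻ = ℕₚ.≤ᵇ⇒≤ _ _ ∘ Equivalence.from Boolₚ.T-≡

anyFin-true : ∀ {k} (f : Fin k → Bool) t → f t ≡ true → anyFin f ≡ true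
anyFin-true f zero    h rewrite h = refl
anyFin-true f (suc t) h rewrite anyFin-true (f ∘ suc) t h = Boolₚ.∨-zeroʳ (f zero)

anyFin-true⁻ : ∀ {k} (f : Fin k → Bool) → anyFin f ≡ true → ∃ λ t → f t ≡ true
anyFin-true⁻ {suc k} f h with f zero in eq
... | true  = zero , eq
... | false = let t , ft = anyFin-true⁻ (f ∘ suc) h in suc t , ft

cardinality : ∀ {k} → (Fin k → Bool) → ℕ
cardinality f = sumℕ (λ t → if f t then 1 else 0)

cardinality-0⁻ : ∀ {k} (f : Fin k → Bool) → cardinality f ≡ 0 → ∀ t → f t ≢ true
cardinality-0⁻ {suc k} f h t ft with f zero in eq
cardinality-0⁻ {suc k} f () t       ft | true
cardinality-0⁻ {suc k} f h  zero    ft | false = contradiction (trans (sym ft) eq) λ ()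
cardinality-0⁻ {suc k} f h  (suc t) ft | false = cardinality-0⁻ (f ∘ suc) h t ft

cardinality-1⁻ : ∀ {k} (f : Fin k → Bool) → cardinality f ≡ 1 →
  ∃ λ p → f p ≡ true × (∀ t → f t ≡ true → t ≡ p)
cardinality-1⁻ {suc k} f h with f zero in eq
... | true = zero , eq , λ where
  zero    _  → refl
  (suc t) ft → contradiction ft (cardinality-0⁻ (f ∘ suc) (ℕₚ.suc-injective h) t)
... | false with p , fp , unique ← cardinality-1⁻ (f ∘ suc) h = suc p , fp , λ where
  zero    ft → contradiction (trans (sym ft) eq) λ ()
  (suc t) ft → cong suc (unique t ft)

cardinality-2⁻ : ∀ {k} (f : Fin k → Bool) → cardinality f ≡ 2 →
  ∃₂ λ p q → p Fin.< q × f p ≡ true × f q ≡ true × (∀ t → f t ≡ true → t ≡ p ⊎ t ≡ q)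
cardinality-2⁻ {suc k} f h with f zero in eq
... | true with q , fq , unique ← cardinality-1⁻ (f ∘ suc) (ℕₚ.suc-injective h) =
  zero , suc q , s≤s z≤n , eq , fq , λ where
    zero    _  → inj₁ refl
    (suc t) ft → inj₂ (cong suc (unique t ft))
... | false with p , q , p<q , fp , fq , unique ← cardinality-2⁻ (f ∘ suc) h =
  suc p , suc q , s≤s p<q , fp , fq , λ where
    zero    ft → contradiction (trans (sym ft) eq) λ ()
    (suc t) ft → Sum.map (cong suc) (cong suc) (unique t ft)

cardinality-0 : ∀ {k} (f : Fin k → Bool) → (∀ t → f t ≢ true) → cardinality f ≡ 0
cardinality-0 {zero}  f h = refl
cardinality-0 {suc k} f h with f zero in eq
... | true  = contradiction eq (h zero)
... | false = cardinality-0 (f ∘ suc) (h ∘ suc)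

cardinality-1 : ∀ {k} (f : Fin k → Bool) p → f p ≡ true → (∀ t → f t ≡ true → t ≡ p) →
  cardinality f ≡ 1
cardinality-1 f zero fp unique rewrite fp =
  cong suc (cardinality-0 (f ∘ suc) (λ t ft → contradiction (unique (suc t) ft) λ ()))
cardinality-1 f (suc p) fp unique with f zero in eq
... | true  = contradiction (unique zero eq) λ ()
... | false = cardinality-1 (f ∘ suc) p fp (λ t ft → Finₚ.suc-injective (unique (suc t) ft))

-- A letter occurring once has `first` equal to `last`, which lets all letters be treated alike. The
-- length `K` is a free parameter, so the arithmetic of `2 * n ∸ 1` does not enter.
record Positions {K n} (b : Fin K → Fin n) : Set where
  field
    first last    : Fin n → Fin K
    first≤last    : ∀ i → first i Fin.≤ last i
    word-first    : ∀ i → b (first i) ≡ i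
    word-last     : ∀ i → b (last i) ≡ i
    position      : ∀ k → k ≡ first (b k) ⊎ k ≡ last (b k)
    single        : Fin n
    single-once   : first single ≡ last single
    single-unique : ∀ i → first i ≡ last i → i ≡ single

  first-least : ∀ k → first (b k) Fin.≤ k
  first-least k with position k
  ... | inj₁ eq = ℕₚ.≤-reflexive (cong toℕ (sym eq))
  ... | inj₂ eq = subst (first (b k) Fin.≤_) (sym eq) (first≤last (b k))

  last-greatest : ∀ k → k Fin.≤ last (b k)
  last-greatest k with position k
  ... | inj₁ eq = subst (Fin._≤ last (b k)) (sym eq) (first≤last (b k))
  ... | inj₂ eq = ℕₚ.≤-reflexive (cong toℕ eq)

positions : ∀ {n} (B : Biperm n) → Positions (proj₁ B)
positions {n} (b , s , once , twice) = record
  { first         = λ i → first (occurrences i)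
  ; last          = λ i → last (occurrences i)
  ; first≤last    = λ i → first≤last (occurrences i)
  ; word-first    = λ i → word-first (occurrences i)
  ; word-last     = λ i → word-last (occurrences i)
  ; position      = λ k → only (occurrences (b k)) k refl
  ; single        = s
  ; single-once   = collapse (occurrences s) refl
  ; single-unique = λ i → single (occurrences i)
  }
  where
  record Occurrences (i : Fin n) : Set where
    field
      first last : Fin (2 ℕ.* n ∸ 1)
      first≤last : first Fin.≤ last
      word-first : b first ≡ i
      word-last  : b last ≡ i
      only       : ∀ k → b k ≡ i → k ≡ first ⊎ k ≡ last
      collapse   : i ≡ s → first ≡ last
      single     : first ≡ last → i ≡ s
  open Occurrences
  occurrences : ∀ i → Occurrences i
  occurrences i with i Fin.≟ s
  ... | yes refl with p , bp , unique ← cardinality-1⁻ _ once = record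
    { first = p ; last = p ; first≤last = ℕₚ.≤-refl
    ; word-first = ⌊⌋-true⁻ (b p Fin.≟ s) bp
    ; word-last  = ⌊⌋-true⁻ (b p Fin.≟ s) bp
    ; only       = λ k bk → inj₁ (unique k (⌊⌋-true (b k Fin.≟ s) bk))
    ; collapse   = λ _ → refl
    ; single     = λ _ → refl
    }
  ... | no i≢s with p , q , p<q , bp , bq , unique ← cardinality-2⁻ _ (twice i i≢s) = record
    { first = p ; last = q ; first≤last = ℕₚ.<⇒≤ p<q
    ; word-first = ⌊⌋-true⁻ (b p Fin.≟ i) bp
    ; word-last  = ⌊⌋-true⁻ (b q Fin.≟ i) bq
    ; only       = λ k bk → unique k (⌊⌋-true (b k Fin.≟ i) bk)
    ; collapse   = λ i≡s → contradiction i≡s i≢s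
    ; single     = λ p≡q → contradiction (cong toℕ p≡q) (ℕₚ.<⇒≢ p<q)
    }

-- The vertex map on rays and cone points

vert : ∀ {n} → (Fin n → Fin 3) → ZVec n
vert l i j = if ⌊ l i Fin.≟ j ⌋ then ℤ.1ℤ else ℤ.0ℤ

vert-cong : ∀ {n} {l l' : Fin n → Fin 3} → (∀ i → l i ≡ l' i) → vert l ≈ᶻ vert l'
vert-cong h i j rewrite h i = refl

vert-injective : ∀ {n} {l l' : Fin n → Fin 3} → vert l ≈ᶻ vert l' → ∀ i → l i ≡ l' i
vert-injective {l = l} {l'} h i with l' i Fin.≟ l i | h i (l i)
... | yes eq | _ = sym eq
... | no _   | eq rewrite ⌊⌋-true (l i Fin.≟ l i) refl = contradiction eq λ ()

-- The order g, e, f puts fⁿ directly before the rays, making the path contiguous in `coneSimplex`.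
coneLabel : Fin 3 → Fin 3
coneLabel 0F = 2F
coneLabel 1F = 0F
coneLabel 2F = 1F

-- The order is a 3-cycle; this yields injectivity on the cone points.
coneLabel-cube : ∀ u → coneLabel (coneLabel (coneLabel u)) ≡ u
coneLabel-cube 0F = refl
coneLabel-cube 1F = refl
coneLabel-cube 2F = refl

ψ : ∀ {n} → Fin 3 → ZVec n
ψ u = vert (const (coneLabel u))

rayLabel : ∀ {n} → Word n → Fin (2 ℕ.* n ∸ 2) → Fin n → Fin 3
rayLabel b m i = pick (inS b m i) (not (inT b m i))

φ : ∀ {n} → Biperm n → Fin (2 ℕ.* n ∸ 2) → ZVec n
φ (b , _) m = vert (rayLabel b m)

-- For a variable n the length 2 * n ∸ 1 does not reduce to suc (2 * n ∸ 2); it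
-- does for 2 + n.
module _ {n} {b : Word (2 ℕ.+ n)} (P : Positions b) where
  open Positions P

  -- Only the first occurrence decides membership in an initial segment. Ray `m`, counted from 0, is
  -- step `suc m` of the path because step 0 is fⁿ.
  inS-first : ∀ m i → inS b m i ≡ (toℕ (first i) ℕ.<ᵇ suc (toℕ m))
  inS-first m i = Boolₚ.⇔→≡ (mk⇔ to from)
    where
    member : Fin _ → Bool
    member k = (toℕ k ℕ.≤ᵇ toℕ m) ∧ ⌊ b k Fin.≟ i ⌋
    to : inS b m i ≡ true → (toℕ (first i) ℕ.<ᵇ suc (toℕ m)) ≡ true
    to h with k , hk ← anyFin-true⁻ member h
      with toℕ k ℕ.≤ᵇ toℕ m in le | b k Fin.≟ i
    ... | true | yes refl = <ᵇ-true (s≤s (ℕₚ.≤-trans (first-least k) (≤ᵇ-true⁻ le)))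
    from : (toℕ (first i) ℕ.<ᵇ suc (toℕ m)) ≡ true → inS b m i ≡ true
    from h = anyFin-true member (first i)
      (cong₂ _∧_ (≤ᵇ-true (ℕₚ.≤-pred (<ᵇ-true⁻ {toℕ (first i)} h)))
        (⌊⌋-true (b (first i) Fin.≟ i) (word-first i)))

  inT-last : ∀ m i → not (inT b m i) ≡ (toℕ (last i) ℕ.<ᵇ suc (toℕ m))
  inT-last m i = trans (cong not (Boolₚ.⇔→≡ (mk⇔ to from))) (Boolₚ.not-involutive _)
    where
    member : Fin _ → Bool
    member k = (suc (toℕ m) ℕ.≤ᵇ toℕ k) ∧ ⌊ b k Fin.≟ i ⌋
    to : inT b m i ≡ true → not (toℕ (last i) ℕ.<ᵇ suc (toℕ m)) ≡ true
    to h with k , hk ← anyFin-true⁻ member h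
      with suc (toℕ m) ℕ.≤ᵇ toℕ k in le | b k Fin.≟ i
    ... | true | yes refl = cong not (Boolₚ.¬-not λ h' → contradiction (<ᵇ-true⁻ h')
      (ℕₚ.≤⇒≯ (ℕₚ.≤-trans (≤ᵇ-true⁻ le) (last-greatest k))))
    from : not (toℕ (last i) ℕ.<ᵇ suc (toℕ m)) ≡ true → inT b m i ≡ true
    from h = anyFin-true member (last i) (cong₂ _∧_
      (≤ᵇ-true {suc (toℕ m)} {toℕ (last i)} (ℕₚ.≮⇒≥ λ lt →
        contradiction (trans (sym (cong not (<ᵇ-true lt))) h) λ ()))
      (⌊⌋-true (b (last i) Fin.≟ i) (word-last i)))

  rayLabel-path : ∀ m i → rayLabel b m i ≡ pathLabel first last (suc (toℕ m)) i
  rayLabel-path m i = cong₂ pick (inS-first m i) (inT-last m i)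

  -- Every letter occurs on at least one side of the cut. This excludes the pair of Booleans on
  -- which `pick` would fail to be injective.
  notT⇒S : ∀ m i → not (inT b m i) ≡ true → inS b m i ≡ true
  notT⇒S m i h = trans (inS-first m i)
    (<ᵇ-antitone (suc (toℕ m)) (first≤last i) (trans (sym (inT-last m i)) h))

  S-nonempty : ∀ m → inS b m (b zero) ≡ true
  S-nonempty m = trans (inS-first m (b zero)) (<ᵇ-true (s≤s (ℕₚ.≤-trans (first-least zero) z≤n)))

  T-nonempty : ∀ m → inT b m (b (fromℕ _)) ≡ true
  T-nonempty m = Boolₚ.not-injective {y = true} (trans (inT-last m _) (Boolₚ.¬-not λ h →
    contradiction (<ᵇ-true⁻ h) (ℕₚ.≤⇒≯ (ℕₚ.≤-trans
      (ℕₚ.≤-trans (Finₚ.toℕ<n m) (ℕₚ.≤-reflexive (sym (Finₚ.toℕ-fromℕ _))))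
      (last-greatest (fromℕ _))))))

  coneSimplex-label : ∀ (B : IsBiperm b) t →
    coneSimplex ψ (φ {2 ℕ.+ n}) (b , B) t ≈ᶻ vert (simplexLabel first last t)
  coneSimplex-label B 0F i j = refl
  coneSimplex-label B 1F i j = refl
  coneSimplex-label B 2F i j = refl
  coneSimplex-label B (suc (suc (suc m))) = vert-cong (rayLabel-path m)

  -- The letter occurring once is never in both S and T, which excludes gⁿ; eⁿ and fⁿ are excluded
  -- since T and S are nonempty.
  ψ-not-ray : ∀ u m → ¬ (∀ i → coneLabel u ≡ rayLabel b m i)
  ψ-not-ray 0F m h = go _ _ (cong (toℕ) single-once) (trans (h single) (rayLabel-path m single))
    where
    -- The two positions become variables, so that after identifying them a single Boolean decides
    -- both comparisons.
    go : ∀ p q → p ≡ q → 2F ≡ pick (p ℕ.<ᵇ suc (toℕ m)) (q ℕ.<ᵇ suc (toℕ m)) → _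
    go p .p refl eq with p ℕ.<ᵇ suc (toℕ m)
    go p .p refl () | true
    go p .p refl () | false
  ψ-not-ray 1F m h with inS b m (b (fromℕ _)) | inT b m (b (fromℕ _)) | T-nonempty m | h (b (fromℕ _))
  ... | true  | true | _ | ()
  ... | false | true | _ | ()
  ψ-not-ray 2F m h with inS b m (b zero) | not (inT b m (b zero)) | S-nonempty m | h (b zero)
  ... | true  | true  | _ | ()
  ... | true  | false | _ | ()

pick-injective : ∀ {s u s' u'} → (u ≡ true → s ≡ true) → (u' ≡ true → s' ≡ true) →
  pick s u ≡ pick s' u' → s ≡ s' × u ≡ u'
pick-injective {true}  {true}  {true}  {true}  _ _ _ = refl , refl
pick-injective {true}  {true}  {false} {true}  _ h _ = contradiction (h refl) λ ()
pick-injective {false} {true}  {_}     {_}     h _ _ = contradiction (h refl) λ ()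
pick-injective {true}  {false} {true}  {false} _ _ _ = refl , refl
pick-injective {false} {false} {false} {false} _ _ _ = refl , refl
pick-injective {true}  {false} {false} {true}  _ _ ()
pick-injective {false} {false} {false} {true}  _ _ ()
pick-injective {true}  {true}  {false} {false} _ _ ()

-- If S' is not constant, then l + c and c are two distinct values of ind, so
-- l = 1 and c = 0; constant indicators of nonempty sets are both 1.
indicators-proportional : ∀ {n} {S S' : Fin n → Bool} {l c j j'} → 0ℚ ℚ.< l →
  (∀ i → ind (S i) ≡ l ℚ.* ind (S' i) ℚ.+ c) → S j ≡ true → S' j' ≡ true →
  ∀ i → S i ≡ S' i
indicators-proportional {S = S} {S'} {l} {c} {j} {j'} 0<l h Sj S'j' i
  with S i in eq | S' i in eq'
... | true  | true  = refl
... | false | false = refl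
... | true  | false = contradiction (ℚₚ.<-≤-trans 1<l+1 l+1≤1) (ℚₚ.<-irrefl refl)
  where
  c≡1 : c ≡ 1ℚ
  c≡1 = sym (trans (subst₂ (λ s s' → ind s ≡ l ℚ.* ind s' ℚ.+ c) eq eq' (h i))
    (trans (cong (ℚ._+ c) (ℚₚ.*-zeroʳ l)) (ℚₚ.+-identityˡ c)))
  1<l+1 : 1ℚ ℚ.< l ℚ.+ 1ℚ
  1<l+1 = subst (ℚ._< l ℚ.+ 1ℚ) (ℚₚ.+-identityˡ 1ℚ) (ℚₚ.+-monoˡ-< 1ℚ 0<l)
  ind≤1 : ∀ s → ind s ℚ.≤ 1ℚ
  ind≤1 true  = ℚₚ.≤-refl
  ind≤1 false = ℚₚ.<⇒≤ (ℚₚ.positive⁻¹ 1ℚ)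
  l+1≤1 : l ℚ.+ 1ℚ ℚ.≤ 1ℚ
  l+1≤1 = subst (ℚ._≤ 1ℚ)
    (trans (subst (λ s' → ind (S j') ≡ l ℚ.* ind s' ℚ.+ c) S'j' (h j'))
      (cong₂ ℚ._+_ (ℚₚ.*-identityʳ l) c≡1))
    (ind≤1 (S j'))
... | false | true  with S' j in eqj
                       | subst (λ s → ind s ≡ l ℚ.* ind (S' j) ℚ.+ c) Sj (h j)
                       | subst₂ (λ s s' → ind s ≡ l ℚ.* ind s' ℚ.+ c) eq eq' (h i)
...   | true  | 1≡ | 0≡ = contradiction (trans 1≡ (sym 0≡)) λ ()
...   | false | 1≡ | 0≡ = contradiction (sym 0≡) (ℚₚ.<⇒≢ 0<l+c ∘ sym)
  where
  c≡1 : c ≡ 1ℚ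
  c≡1 = sym (trans 1≡ (trans (cong (ℚ._+ c) (ℚₚ.*-zeroʳ l)) (ℚₚ.+-identityˡ c)))
  0<l+c : 0ℚ ℚ.< l ℚ.* 1ℚ ℚ.+ c
  0<l+c = subst₂ (λ x y → 0ℚ ℚ.< x ℚ.+ y) (sym (ℚₚ.*-identityʳ l)) (sym c≡1)
    (ℚₚ.<-trans 0<l (subst (ℚ._< l ℚ.+ 1ℚ) (ℚₚ.+-identityʳ l) (ℚₚ.+-monoʳ-< l (ℚₚ.positive⁻¹ 1ℚ))))

vertexEmbedding : ∀ {n} → IsVertexEmbedding {2 ℕ.+ n} ψ φ
vertexEmbedding {n} = ψ-injective , (λ u B m h → ψ-not-ray (positions B) u m (vert-injective h)) ,
  well-defined , injective
  where
  ψ-injective : ∀ u v → ψ {2 ℕ.+ n} u ≈ᶻ ψ v → u ≡ v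
  ψ-injective u v h = trans (sym (coneLabel-cube u))
    (trans (cong (coneLabel ∘ coneLabel) (vert-injective h zero)) (coneLabel-cube v))
  well-defined : ∀ B m B' m' → SameRay (gen B m) (gen B' m') → φ {2 ℕ.+ n} B m ≈ᶻ φ B' m'
  well-defined B m B' m' (l , c , d , 0<l , hS , hT) = vert-cong λ i → cong₂ pick
    (indicators-proportional {S = inS (proj₁ B) m} {S' = inS (proj₁ B') m'} 0<l hS
      (S-nonempty P m) (S-nonempty P' m') i)
    (cong not (indicators-proportional {S = inT (proj₁ B) m} {S' = inT (proj₁ B') m'} 0<l hT
      (T-nonempty P m) (T-nonempty P' m') i))
    where P = positions B ; P' = positions B'
  injective : ∀ B m B' m' → φ {2 ℕ.+ n} B m ≈ᶻ φ B' m' → SameRay (gen B m) (gen B' m')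
  -- Labels recover S and T, so the two generators coincide without scaling or shift.
  injective B m B' m' h = 1ℚ , 0ℚ , 0ℚ , ℚₚ.positive⁻¹ 1ℚ ,
    (λ i → same (proj₁ (equal i))) ,
    (λ i → same (Boolₚ.not-injective (proj₂ (equal i))))
    where
    equal : ∀ i → inS (proj₁ B) m i ≡ inS (proj₁ B') m' i ×
                  not (inT (proj₁ B) m i) ≡ not (inT (proj₁ B') m' i)
    equal i = pick-injective (notT⇒S (positions B) m i) (notT⇒S (positions B') m' i)
      (vert-injective h i)
    same : ∀ {s s'} → s ≡ s' → ind s ≡ 1ℚ ℚ.* ind s' ℚ.+ 0ℚ
    same {s' = s'} refl = sym (trans (ℚₚ.+-identityʳ _) (ℚₚ.*-identityˡ (ind s')))

-- Unimodularity

module ℤΣ = PartialSums ℤₚ.+-*-commutativeRing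

sumℤ≡sum : ∀ {k} (x : Fin k → ℤ) → sumℤ x ≡ ℤΣ.sum x
sumℤ≡sum {zero}  x = refl
sumℤ≡sum {suc k} x = cong (λ s → x zero ℤ.+ s) (sumℤ≡sum (x ∘ suc))

sumℤ-cong : ∀ {k} {x y : Fin k → ℤ} → (∀ t → x t ≡ y t) → sumℤ x ≡ sumℤ y
sumℤ-cong {zero}  h = refl
sumℤ-cong {suc k} h = cong₂ ℤ._+_ (h zero) (sumℤ-cong (h ∘ suc))

vert-edge-inLattice : ∀ {n} (l l' : Fin n → Fin 3) →
  InLattice (λ i j → vert l i j ℤ.- vert l' i j)
vert-edge-inLattice l l' i with l i | l' i
... | 0F | 0F = refl
... | 0F | 1F = refl
... | 0F | 2F = refl
... | 1F | 0F = refl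
... | 1F | 1F = refl
... | 1F | 2F = refl
... | 2F | 0F = refl
... | 2F | 1F = refl
... | 2F | 2F = refl

module _ {K n} {b : Fin K → Fin n} (P : Positions b) where
  open Positions P

  -- With gⁿ as base point, edge vectors agree with vertices in the e- and f-coordinates, and the
  -- lattice condition fixes the g-coordinate. The coordinate formulas then solve the linear system
  -- over ℤ.
  unimodular : (σ : Fin (2 ℕ.+ K) → ZVec n) →
    (∀ t → σ t ≈ᶻ vert (simplexLabel first last t)) → Unimodular σ
  unimodular σ h = edge-inLattice , spanning , independent
    where
    open ≡-Reasoning
    edge : Fin (suc K) → ZVec n
    edge t i j = σ (suc t) i j ℤ.- σ 0F i j

    edge-inLattice : ∀ t → InLattice (edge t)
    edge-inLattice t i = trans
      (sumℤ-cong (λ j → cong₂ ℤ._-_ (h (suc t) i j) (h 0F i j)))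
      (vert-edge-inLattice (simplexLabel first last (suc t)) (simplexLabel first last 0F) i)

    combination : (Fin (suc K) → ℤ) → ZVec n
    combination c i j = sumℤ (λ t → c t ℤ.* edge t i j)

    -- Outside the g-coordinate the base point is zero, so `x 0F` may be arbitrary.
    coordinates : (x : Fin (2 ℕ.+ K) → ℤ) → ∀ i j → ⌊ 2F Fin.≟ j ⌋ ≡ false →
      combination (x ∘ suc) i j ≡ ℤΣ.coordinate first last x i j
    coordinates x i j g = begin
      combination (x ∘ suc) i j
        ≡⟨ sumℤ-cong (λ t → cong (x (suc t) ℤ.*_) (step t)) ⟩
      sumℤ (λ t → x (suc t) ℤ.* vert (simplexLabel first last (suc t)) i j)
        ≡⟨ sumℤ≡sum (λ t → x (suc t) ℤ.* vert (simplexLabel first last (suc t)) i j) ⟩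
      ℤΣ.sum (λ t → x (suc t) ℤ.* vert (simplexLabel first last (suc t)) i j)
        ≡⟨ trans (cong (ℤ._+ s) (trans (cong (x 0F ℤ.*_) (cong ℤΣ.𝟙 g)) (ℤₚ.*-zeroʳ (x 0F))))
             (ℤₚ.+-identityˡ s) ⟨
      ℤΣ.coordinate first last x i j ∎
      where
      s = ℤΣ.sum (λ t → x (suc t) ℤ.* vert (simplexLabel first last (suc t)) i j)
      step : ∀ t → edge t i j ≡ vert (simplexLabel first last (suc t)) i j
      step t = begin
        σ (suc t) i j ℤ.- σ 0F i j  ≡⟨ cong₂ ℤ._-_ (h (suc t) i j) (trans (h 0F i j) (cong ℤΣ.𝟙 g)) ⟩
        vert (simplexLabel first last (suc t)) i j ℤ.- ℤ.0ℤ ≡⟨ ℤₚ.+-identityʳ _ ⟩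
        vert (simplexLabel first last (suc t)) i j ∎

    combination-inLattice : ∀ c → InLattice (combination c)
    combination-inLattice c i = begin
      sumℤ (combination c i)           ≡⟨ sumℤ-cong (λ j → sumℤ≡sum (λ t → c t ℤ.* edge t i j)) ⟩
      sumℤ (λ j → ℤΣ.sum (λ t → c t ℤ.* edge t i j))
        ≡⟨ sumℤ≡sum (λ j → ℤΣ.sum (λ t → c t ℤ.* edge t i j)) ⟩
      ℤΣ.sum (λ j → ℤΣ.sum (λ t → c t ℤ.* edge t i j))
        ≡⟨ ℤΣ.sum-combination c (λ t j → edge t i j) ℤ.0ℤ
             (λ t → trans (sym (sumℤ≡sum (edge t i))) (edge-inLattice t i)) ⟩
      ℤΣ.sum c ℤ.* ℤ.0ℤ                ≡⟨ ℤₚ.*-zeroʳ (ℤΣ.sum c) ⟩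
      ℤ.0ℤ ∎

    spanning : ∀ z → InLattice z → Σ (Fin (suc K) → ℤ) λ c → ∀ i j → z i j ≡ combination c i j
    spanning z z∈ = solution ∘ suc , λ i j →
      sym (ℤΣ.third-determined (combination (solution ∘ suc) i) (z i)
        (trans (sym (sumℤ≡sum (combination (solution ∘ suc) i)))
          (trans (combination-inLattice (solution ∘ suc) i)
            (trans (sym (z∈ i)) (sumℤ≡sum (z i)))))
        (trans (coordinates solution i 0F refl)
          (ℤΣ.solution-e first last ℤ.0ℤ r w (λ i → z i 0F) (λ i → z i 1F) w-last i))
        (trans (coordinates solution i 1F refl)
          (ℤΣ.solution-f first last ℤ.0ℤ r w (λ i → z i 0F) (λ i → z i 1F) w-first first≤last i))
        j)
      where
      -- Forced by the letter occurring once: its two prescribed prefix values, f and r - e, belong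
      -- to the same position.
      r : ℤ
      r = z single 0F ℤ.+ z single 1F
      w : Fin K → ℤ
      w k = if ⌊ k Fin.≟ first (b k) ⌋ then z (b k) 1F else r ℤ.- z (b k) 0F
      solution : Fin (2 ℕ.+ K) → ℤ
      solution = ℤΣ.solution ℤ.0ℤ r w
      w-first : ∀ i → w (first i) ≡ z i 1F
      w-first i rewrite word-first i | ⌊⌋-true (first i Fin.≟ first i) refl = refl
      w-last : ∀ i → w (last i) ≡ r ℤ.- z i 0F
      w-last i rewrite word-last i with last i Fin.≟ first i
      ... | no _ = refl
      ... | yes eq with refl ← single-unique i (sym eq) =
        sym (AbelianGroupProperties.xyx⁻¹≈y ℤₚ.+-0-abelianGroup (z i 0F) (z i 1F))

    -- The f-coordinates kill the prefix sums at first occurrences, and the e-coordinates make those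
    -- at last occurrences equal to the total. The letter occurring once links the two, so every
    -- prefix sum vanishes.
    independent : ∀ c → (∀ i j → combination c i j ≡ ℤ.0ℤ) → ∀ t → c t ≡ ℤ.0ℤ
    independent c c≡0 = λ where
        zero    → trans (sym total≡) (total≡0)
        (suc m) → y≡0 m
      where
      x : Fin (2 ℕ.+ K) → ℤ
      x = ℤ.0ℤ Vector.∷ c
      y : Fin K → ℤ
      y m = c (suc m)
      total : ℤ
      total = c zero ℤ.+ ℤΣ.sum y
      prefix-first : ∀ i → ℤΣ.prefix y (first i) ≡ ℤ.0ℤ
      prefix-first i = trans (sym (ℤΣ.coordinate-f first last x i (first≤last i)))
        (trans (sym (coordinates x i 1F refl)) (c≡0 i 1F))
      prefix-last : ∀ i → ℤΣ.prefix y (last i) ≡ total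
      prefix-last i = begin
        ℤΣ.prefix y (last i)  ≡⟨ ℤₚ.+-identityʳ _ ⟨
        ℤΣ.prefix y (last i) ℤ.+ ℤ.0ℤ
          ≡⟨ cong (λ e → ℤΣ.prefix y (last i) ℤ.+ e) (trans (sym (coordinates x i 0F refl)) (c≡0 i 0F)) ⟨
        ℤΣ.prefix y (last i) ℤ.+ ℤΣ.coordinate first last x i 0F
          ≡⟨ ℤΣ.coordinate-e first last x i ⟩
        total ∎
      total≡0 : total ≡ ℤ.0ℤ
      total≡0 = trans (sym (prefix-last single))
        (trans (cong (ℤΣ.prefix y) (sym single-once)) (prefix-first single))
      prefix≡0 : ∀ k → ℤΣ.prefix y k ≡ ℤ.0ℤ
      prefix≡0 k with position k
      ... | inj₁ eq = trans (cong (ℤΣ.prefix y) eq) (prefix-first (b k))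
      ... | inj₂ eq = trans (cong (ℤΣ.prefix y) eq) (trans (prefix-last (b k)) total≡0)
      y≡0 : ∀ m → y m ≡ ℤ.0ℤ
      y≡0 = ℤΣ.prefix-zero y prefix≡0
      total≡ : total ≡ c zero
      total≡ = trans (cong (λ s → c zero ℤ.+ s) (ℤΣ.sum-zero y y≡0)) (ℤₚ.+-identityʳ (c zero))

-- Simplices over ℚ

module ℚΣ = PartialSums ℚₚ.+-*-commutativeRing
open ℚΣ using (prefix)

sumℚ≡sum : ∀ {k} (x : Fin k → ℚ) → sumℚ x ≡ ℚΣ.sum x
sumℚ≡sum {zero}  x = refl
sumℚ≡sum {suc k} x = cong (x zero ℚ.+_) (sumℚ≡sum (x ∘ suc))

sumℚ-cong : ∀ {k} {x y : Fin k → ℚ} → (∀ t → x t ≡ y t) → sumℚ x ≡ sumℚ y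
sumℚ-cong {zero}  h = refl
sumℚ-cong {suc k} h = cong₂ ℚ._+_ (h zero) (sumℚ-cong (h ∘ suc))

sumℚ-nonneg : ∀ {k} (x : Fin k → ℚ) → (∀ t → 0ℚ ℚ.≤ x t) → 0ℚ ℚ.≤ sumℚ x
sumℚ-nonneg {zero}  x h = ℚₚ.≤-refl
sumℚ-nonneg {suc k} x h = ℚₚ.+-mono-≤ (h zero) (sumℚ-nonneg (x ∘ suc) (h ∘ suc))

p≤p+q : ∀ p {q} → 0ℚ ℚ.≤ q → p ℚ.≤ p ℚ.+ q
p≤p+q p {q} 0≤q = subst (ℚ._≤ p ℚ.+ q) (ℚₚ.+-identityʳ p) (ℚₚ.+-monoʳ-≤ p 0≤q)

0≤q-p : ∀ {p q} → p ℚ.≤ q → 0ℚ ℚ.≤ q ℚ.- p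
0≤q-p {p} {q} p≤q = subst (ℚ._≤ q ℚ.- p) (ℚₚ.+-inverseʳ p) (ℚₚ.+-monoˡ-≤ (ℚ.- p) p≤q)

≤∧≢⇒< : ∀ {p q} → p ℚ.≤ q → q ≢ p → p ℚ.< q
≤∧≢⇒< {p} {q} p≤q q≢p with ℚₚ.<-cmp p q
... | tri< p<q _ _ = p<q
... | tri≈ _ p≡q _ = contradiction (sym p≡q) q≢p
... | tri> _ _ q<p = contradiction (ℚₚ.<-≤-trans q<p p≤q) (ℚₚ.<-irrefl refl)

-- Partial sums of nonnegative weights

before : ∀ {k} → (Fin k → ℚ) → Fin k → ℚ
before y zero    = 0ℚ
before y (suc m) = y zero ℚ.+ before (y ∘ suc) m

before+ : ∀ {k} (y : Fin k → ℚ) m → before y m ℚ.+ y m ≡ prefix y m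
before+ y zero    = ℚₚ.+-identityˡ (y zero)
before+ y (suc m) = trans (ℚₚ.+-assoc (y zero) _ _) (cong (y zero ℚ.+_) (before+ (y ∘ suc) m))

before<prefix : ∀ {k} (y : Fin k → ℚ) m → 0ℚ ℚ.< y m → before y m ℚ.< prefix y m
before<prefix y m 0<ym = subst₂ ℚ._<_ (ℚₚ.+-identityʳ _) (before+ y m) (ℚₚ.+-monoʳ-< (before y m) 0<ym)

before-nonneg : ∀ {k} (y : Fin k → ℚ) → (∀ m → 0ℚ ℚ.≤ y m) → ∀ m → 0ℚ ℚ.≤ before y m
before-nonneg y y≥0 zero    = ℚₚ.≤-refl
before-nonneg y y≥0 (suc m) = ℚₚ.+-mono-≤ (y≥0 zero) (before-nonneg (y ∘ suc) (y≥0 ∘ suc) m)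

prefix-nonneg : ∀ {k} (y : Fin k → ℚ) → (∀ m → 0ℚ ℚ.≤ y m) → ∀ m → 0ℚ ℚ.≤ prefix y m
prefix-nonneg y y≥0 m =
  subst (0ℚ ℚ.≤_) (before+ y m) (ℚₚ.+-mono-≤ (before-nonneg y y≥0 m) (y≥0 m))

prefix≤before : ∀ {k} (y : Fin k → ℚ) → (∀ m → 0ℚ ℚ.≤ y m) →
  ∀ {p m} → p Fin.< m → prefix y p ℚ.≤ before y m
prefix≤before y y≥0 {zero}  {suc m} _         = p≤p+q (y zero) (before-nonneg (y ∘ suc) (y≥0 ∘ suc) m)
prefix≤before y y≥0 {suc p} {suc m} (s≤s p<m) =
  ℚₚ.+-monoʳ-≤ (y zero) (prefix≤before (y ∘ suc) (y≥0 ∘ suc) p<m)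

prefix-mono : ∀ {k} (y : Fin k → ℚ) → (∀ m → 0ℚ ℚ.≤ y m) →
  ∀ {m p} → m Fin.≤ p → prefix y m ℚ.≤ prefix y p
prefix-mono y y≥0 {zero}  {zero}  _         = ℚₚ.≤-refl
prefix-mono y y≥0 {zero}  {suc p} _         = p≤p+q (y zero) (prefix-nonneg (y ∘ suc) (y≥0 ∘ suc) p)
prefix-mono y y≥0 {suc m} {suc p} (s≤s m≤p) = ℚₚ.+-monoʳ-≤ (y zero) (prefix-mono (y ∘ suc) (y≥0 ∘ suc) m≤p)

prefix≤sum : ∀ {k} (y : Fin k → ℚ) → (∀ m → 0ℚ ℚ.≤ y m) → ∀ p → prefix y p ℚ.≤ sumℚ y
prefix≤sum y y≥0 zero    = p≤p+q (y zero) (sumℚ-nonneg (y ∘ suc) (y≥0 ∘ suc))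
prefix≤sum y y≥0 (suc p) = ℚₚ.+-monoʳ-≤ (y zero) (prefix≤sum (y ∘ suc) (y≥0 ∘ suc) p)

-- The weight `y m` is laid out as the half-open interval from `before y m` to `prefix y m`; a zero
-- weight gives an empty interval.
Straddles : ∀ {k} → ℚ → (Fin k → ℚ) → Fin k → Set
Straddles τ y m = before y m ℚ.≤ τ × τ ℚ.< prefix y m

straddle : ∀ {k} (y : Fin k → ℚ) {τ} → 0ℚ ℚ.≤ τ → (∃ λ m → Straddles τ y m) ⊎ sumℚ y ℚ.≤ τ
straddle y {τ} 0≤τ = relax (go y 0ℚ 0≤τ)
  where
  -- Here `a` is the weight already passed; the scan stops at the first partial sum exceeding τ.
  go : ∀ {k} (y : Fin k → ℚ) a → a ℚ.≤ τ →
    (∃ λ m → a ℚ.+ before y m ℚ.≤ τ × τ ℚ.< a ℚ.+ prefix y m) ⊎ a ℚ.+ sumℚ y ℚ.≤ τ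
  go {zero}  y a a≤τ = inj₂ (subst (ℚ._≤ τ) (sym (ℚₚ.+-identityʳ a)) a≤τ)
  go {suc k} y a a≤τ with τ ℚ.<? a ℚ.+ y zero
  ... | yes lt = inj₁ (zero , subst (ℚ._≤ τ) (sym (ℚₚ.+-identityʳ a)) a≤τ , lt)
  ... | no ¬lt with go (y ∘ suc) (a ℚ.+ y zero) (ℚₚ.≮⇒≥ ¬lt)
  ...   | inj₁ (m , le , lt) = inj₁ (suc m , subst (ℚ._≤ τ) (ℚₚ.+-assoc a _ _) le ,
                                             subst (τ ℚ.<_) (ℚₚ.+-assoc a _ _) lt)
  ...   | inj₂ le = inj₂ (subst (ℚ._≤ τ) (ℚₚ.+-assoc a _ _) le)
  relax : (∃ λ m → 0ℚ ℚ.+ before y m ℚ.≤ τ × τ ℚ.< 0ℚ ℚ.+ prefix y m) ⊎ 0ℚ ℚ.+ sumℚ y ℚ.≤ τ →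
    (∃ λ m → Straddles τ y m) ⊎ sumℚ y ℚ.≤ τ
  relax (inj₁ (m , le , lt)) = inj₁ (m , subst (ℚ._≤ τ) (ℚₚ.+-identityˡ _) le ,
                                         subst (τ ℚ.<_) (ℚₚ.+-identityˡ _) lt)
  relax (inj₂ le) = inj₂ (subst (ℚ._≤ τ) (ℚₚ.+-identityˡ _) le)

-- Monotonicity of partial sums turns a comparison of positions into one of heights. The heights at
-- first and last occurrences can be read off from the point.
straddle-compare : ∀ {k} (y : Fin k → ℚ) → (∀ m → 0ℚ ℚ.≤ y m) → ∀ {τ} m → Straddles τ y m →
  ∀ p → (toℕ p ℕ.<ᵇ toℕ m) ≡ ⌊ prefix y p ℚ.≤? τ ⌋
straddle-compare y y≥0 {τ} m (le , lt) p = Boolₚ.⇔→≡ (mk⇔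
  (λ p<m → ⌊⌋-true (prefix y p ℚ.≤? τ)
    (ℚₚ.≤-trans (prefix≤before y y≥0 {p} {m} (<ᵇ-true⁻ {toℕ p} p<m)) le))
  (λ le' → <ᵇ-true {toℕ p} {toℕ m} (ℕₚ.≰⇒> λ m≤p → ℚₚ.<-irrefl refl (ℚₚ.<-≤-trans lt
    (ℚₚ.≤-trans (prefix-mono y y≥0 {m} {p} m≤p) (⌊⌋-true⁻ (prefix y p ℚ.≤? τ) le'))))))

diff-nonneg : ∀ {k} a (w : Fin k → ℚ) → (∀ m → a ℚ.≤ w m) →
  (∀ {i j} → i Fin.≤ j → w i ℚ.≤ w j) → ∀ m → 0ℚ ℚ.≤ ℚΣ.diff a w m
diff-nonneg a w a≤w mono zero    = 0≤q-p (a≤w zero)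
diff-nonneg a w a≤w mono (suc m) =
  diff-nonneg (w zero) (w ∘ suc) (λ m → mono z≤n) (λ i≤j → mono (s≤s i≤j)) m

-- Sorting finitely many rationals

argmin : ∀ {k} (f : Fin (suc k) → ℚ) → ∃ λ i → ∀ j → f i ℚ.≤ f j
argmin {zero}  f = zero , λ where zero → ℚₚ.≤-refl
argmin {suc k} f with i , least ← argmin (f ∘ suc) with ℚₚ.≤-total (f zero) (f (suc i))
... | inj₁ le = zero , λ where
  zero    → ℚₚ.≤-refl
  (suc j) → ℚₚ.≤-trans le (least j)
... | inj₂ le = suc i , λ where
  zero    → le
  (suc j) → least j

-- Selection sort: `Perm.insert` sends the front position to a minimal index, and the remaining
-- indices are sorted recursively.
sort : ∀ {k} (f : Fin k → ℚ) → Σ (Permutation′ k) λ π →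
  ∀ {i j} → i Fin.≤ j → f (π ⟨$⟩ʳ i) ℚ.≤ f (π ⟨$⟩ʳ j)
sort {zero}  f = Perm.id , λ {i} → contradiction i Finₚ.¬Fin0
sort {suc k} f with i₀ , least ← argmin f with π , mono ← sort (f ∘ punchIn i₀) =
  Perm.insert zero i₀ π , sorted
  where
  sorted : ∀ {i j} → i Fin.≤ j →
    f (Perm.insert zero i₀ π ⟨$⟩ʳ i) ℚ.≤ f (Perm.insert zero i₀ π ⟨$⟩ʳ j)
  sorted {zero}  {j}     _         = least _
  sorted {suc i} {suc j} (s≤s i≤j) = subst₂ (λ p q → f p ℚ.≤ f q)
    (sym (Perm.insert-punchIn zero i₀ π i)) (sym (Perm.insert-punchIn zero i₀ π j)) (mono i≤j)

-- Points of a simplex and their coefficients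

toℚ-vert : ∀ {n} (l : Fin n → Fin 3) i j → toℚ (vert l i j) ≡ ℚΣ.𝟙 ⌊ l i Fin.≟ j ⌋
toℚ-vert l i j with ⌊ l i Fin.≟ j ⌋
... | true  = refl
... | false = refl

vert-sum : ∀ (a : Fin 3) → ℚΣ.sum (λ j → ℚΣ.𝟙 ⌊ a Fin.≟ j ⌋) ≡ 1ℚ
vert-sum 0F = refl
vert-sum 1F = refl
vert-sum 2F = refl

module _ {K n} {b : Fin K → Fin n} (P : Positions b) (σ : Fin (2 ℕ.+ K) → ZVec n)
         (h : ∀ t → σ t ≈ᶻ vert (simplexLabel (Positions.first P) (Positions.last P) t)) where
  open Positions P

  combination-coordinate : ∀ c i j →
    sumℚ (λ t → c t ℚ.* toℚ (σ t i j)) ≡ ℚΣ.coordinate first last c i j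
  combination-coordinate c i j = trans
    (sumℚ-cong (λ t → cong (c t ℚ.*_)
      (trans (cong toℚ (h t i j)) (toℚ-vert (simplexLabel first last t) i j))))
    (sumℚ≡sum (λ t → c t ℚ.* ℚΣ.𝟙 ⌊ simplexLabel first last t i Fin.≟ j ⌋))

  coordinate-sum : ∀ c i → sumℚ c ≡ 1ℚ → ℚΣ.sum (ℚΣ.coordinate first last c i) ≡ 1ℚ
  coordinate-sum c i c≡1 = trans
    (ℚΣ.sum-combination c (λ t j → ℚΣ.𝟙 ⌊ simplexLabel first last t i Fin.≟ j ⌋) 1ℚ
      (λ t → vert-sum (simplexLabel first last t i)))
    (trans (ℚₚ.*-identityʳ _) (trans (sym (sumℚ≡sum c)) c≡1))

  inConv⇒inDelta : ∀ x → InConv σ x → InDelta x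
  inConv⇒inDelta x (c , c≥0 , _ , c≡1 , x≡) = x≥0 , λ i →
    trans (sumℚ-cong (x≡coordinate i))
      (trans (sumℚ≡sum (ℚΣ.coordinate first last c i)) (coordinate-sum c i c≡1))
    where
    x≡coordinate : ∀ i j → x i j ≡ ℚΣ.coordinate first last c i j
    x≡coordinate i j = trans (x≡ i j) (combination-coordinate c i j)
    scaled : ∀ t b → 0ℚ ℚ.≤ c t ℚ.* ℚΣ.𝟙 b
    scaled t true  = subst (0ℚ ℚ.≤_) (sym (ℚₚ.*-identityʳ (c t))) (c≥0 t)
    scaled t false = ℚₚ.≤-reflexive (sym (ℚₚ.*-zeroʳ (c t)))
    x≥0 : ∀ i j → 0ℚ ℚ.≤ x i j
    x≥0 i j = subst (0ℚ ℚ.≤_)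
      (trans (sumℚ≡sum (λ t → c t ℚ.* ℚΣ.𝟙 ⌊ simplexLabel first last t i Fin.≟ j ⌋)) (sym (x≡coordinate i j)))
      (sumℚ-nonneg _ (λ t → scaled t ⌊ simplexLabel first last t i Fin.≟ j ⌋))

  module Decomposition {x : QVec n} (x∈ : InConv σ x) where
    c : Fin (2 ℕ.+ K) → ℚ
    c = proj₁ x∈
    c≥0 : ∀ t → 0ℚ ℚ.≤ c t
    c≥0 = proj₁ (proj₂ x∈)
    c≡1 : sumℚ c ≡ 1ℚ
    c≡1 = proj₁ (proj₂ (proj₂ (proj₂ x∈)))
    x≡ : ∀ i j → x i j ≡ sumℚ (λ t → c t ℚ.* toℚ (σ t i j))
    x≡ = proj₂ (proj₂ (proj₂ (proj₂ x∈)))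
    y : Fin K → ℚ
    y m = c (suc (suc m))
    y≥0 : ∀ m → 0ℚ ℚ.≤ y m
    y≥0 m = c≥0 (suc (suc m))
    r : ℚ
    r = c 1F ℚ.+ sumℚ y

    x-e : ∀ i → prefix y (last i) ℚ.+ x i 0F ≡ r
    x-e i = trans (cong (prefix y (last i) ℚ.+_) (trans (x≡ i 0F) (combination-coordinate c i 0F)))
      (trans (ℚΣ.coordinate-e first last c i) (cong (c 1F ℚ.+_) (sym (sumℚ≡sum y))))

    x-f : ∀ i → x i 1F ≡ prefix y (first i)
    x-f i = trans (x≡ i 1F) (trans (combination-coordinate c i 1F)
      (ℚΣ.coordinate-f first last c i (first≤last i)))

    prefix-last : ∀ i → prefix y (last i) ≡ r ℚ.- x i 0F
    prefix-last i = trans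
      (sym (AbelianGroupProperties.//-rightDividesʳ ℚₚ.+-0-abelianGroup (x i 0F) (prefix y (last i))))
      (cong (ℚ._- x i 0F) (x-e i))

    -- The prefix at `first i` is at most the one at `last i`. Together with `f+e≡r` this makes r a
    -- maximum depending on the point alone.
    f+e≤r : ∀ i → x i 1F ℚ.+ x i 0F ℚ.≤ r
    f+e≤r i = subst₂ ℚ._≤_ (cong (ℚ._+ x i 0F) (sym (x-f i))) (x-e i)
      (ℚₚ.+-monoˡ-≤ (x i 0F) (prefix-mono y y≥0 (first≤last i)))

    f+e≡r : x single 1F ℚ.+ x single 0F ≡ r
    f+e≡r = trans (cong (ℚ._+ x single 0F) (trans (x-f single) (cong (prefix y) single-once)))
      (x-e single)

    -- Which vertex of the path carries the weight located at height τ is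
    -- visible from the point x alone.
    thresholdLabel : ℚ → ℚ → Fin n → Fin 3
    thresholdLabel r τ i = pick ⌊ x i 1F ℚ.≤? τ ⌋ ⌊ r ℚ.- x i 0F ℚ.≤? τ ⌋

    straddle-label : ∀ {τ} m → Straddles τ y m →
      ∀ i → pathLabel first last (toℕ m) i ≡ thresholdLabel r τ i
    straddle-label {τ} m s i = cong₂ pick
      (trans (straddle-compare y y≥0 m s (first i)) (cong (λ v → ⌊ v ℚ.≤? τ ⌋) (sym (x-f i))))
      (trans (straddle-compare y y≥0 m s (last i)) (cong (λ v → ⌊ v ℚ.≤? τ ⌋) (prefix-last i)))

    overflow-label : ∀ {τ} → sumℚ y ℚ.≤ τ → ∀ i → 0F ≡ thresholdLabel r τ i
    overflow-label {τ} le i = sym (cong (pick ⌊ x i 1F ℚ.≤? τ ⌋)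
      (⌊⌋-true (r ℚ.- x i 0F ℚ.≤? τ) (subst (ℚ._≤ τ) (prefix-last i)
        (ℚₚ.≤-trans (prefix≤sum y y≥0 (last i)) le))))

    -- A height beyond the whole weight of the path belongs to its endpoint eⁿ.
    vertex-at : ∀ {τ} → 0ℚ ℚ.≤ τ → ∃ λ t → ∀ i → simplexLabel first last t i ≡ thresholdLabel r τ i
    vertex-at 0≤τ with straddle y 0≤τ
    ... | inj₁ (m , s) = suc (suc m) , straddle-label m s
    ... | inj₂ le      = 1F , overflow-label le

-- Intersection of two simplices

≈ᶻ-via : ∀ {n} {u v : ZVec n} {l l'} → u ≈ᶻ vert l → v ≈ᶻ vert l' → (∀ i → l i ≡ l' i) → u ≈ᶻ v
≈ᶻ-via hu hv eq i j = trans (hu i j) (trans (vert-cong eq i j) (sym (hv i j)))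

-- The first decomposition already works: each of its vertices of positive weight is the threshold
-- labelling at some height, and the second simplex has a vertex with that same labelling.
inConv-common : ∀ {K K' n} {b : Fin K → Fin n} {b' : Fin K' → Fin n}
  (P : Positions b) (P' : Positions b')
  (σ : Fin (2 ℕ.+ K) → ZVec n) (σ' : Fin (2 ℕ.+ K') → ZVec n) →
  (∀ t → σ t ≈ᶻ vert (simplexLabel (Positions.first P) (Positions.last P) t)) →
  (∀ t → σ' t ≈ᶻ vert (simplexLabel (Positions.first P') (Positions.last P') t)) →
  ∀ x → InConv σ x → InConv σ' x → InConvCommon σ σ' x
inConv-common {n = n} P P' σ σ' h h' x x∈ x∈' = D.c , D.c≥0 , common , D.c≡1 , D.x≡
  where
  module P  = Positions P
  module P' = Positions P'
  module D  = Decomposition P σ h x∈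
  module D' = Decomposition P' σ' h' x∈'
  r≡r' : D.r ≡ D'.r
  r≡r' = ℚₚ.≤-antisym
    (subst (ℚ._≤ D'.r) D.f+e≡r (D'.f+e≤r P.single))
    (subst (ℚ._≤ D.r) D'.f+e≡r (D.f+e≤r P'.single))
  common : ∀ t → D.c t ≢ 0ℚ → Σ (Fin _) λ s → σ t ≈ᶻ σ' s
  common 0F ct≢0 = 0F , ≈ᶻ-via (h 0F) (h' 0F) (λ i → refl)
  common 1F ct≢0 = 1F , ≈ᶻ-via (h 1F) (h' 1F) (λ i → refl)
  -- The height chosen is the left end of the interval of `m`, which is nonempty because its weight
  -- is positive.
  common (suc (suc m)) ct≢0 with s , eq ← D'.vertex-at (before-nonneg D.y D.y≥0 m) =
    s , ≈ᶻ-via (h (suc (suc m))) (h' s) (λ i → trans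
      (D.straddle-label m (ℚₚ.≤-refl , before<prefix D.y m (≤∧≢⇒< (D.y≥0 m) ct≢0)) i)
      (trans (cong (λ r → D.thresholdLabel r (before D.y m) i) r≡r') (sym (eq i))))

-- Covering

sumℕ≡sum : ∀ {k} (f : Fin k → ℕ) → sumℕ f ≡ ∑ℕ f
sumℕ≡sum {zero}  f = refl
sumℕ≡sum {suc k} f = cong (f zero ℕ.+_) (sumℕ≡sum (f ∘ suc))

cardinality-cong : ∀ {k} {f g : Fin k → Bool} → (∀ t → f t ≡ g t) → cardinality f ≡ cardinality g
cardinality-cong {zero}  h = refl
cardinality-cong {suc k} h rewrite h zero = cong (_ ℕ.+_) (cardinality-cong (h ∘ suc))

cardinality-permute : ∀ {k} (f : Fin k → Bool) (π : Permutation′ k) →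
  cardinality (f ∘ (π ⟨$⟩ʳ_)) ≡ cardinality f
cardinality-permute f π = trans (sumℕ≡sum (λ t → if f (π ⟨$⟩ʳ t) then 1 else 0))
  (trans (sym (∑ℕ-permute (λ t → if f t then 1 else 0) π)) (sym (sumℕ≡sum (λ t → if f t then 1 else 0))))

cardinality-+ : ∀ k {l} (f : Fin (k ℕ.+ l) → Bool) →
  cardinality f ≡ cardinality (f ∘ (_↑ˡ l)) ℕ.+ cardinality (f ∘ (k ↑ʳ_))
cardinality-+ zero    f = refl
cardinality-+ (suc k) f = trans (cong (λ m → (if f zero then 1 else 0) ℕ.+ m) (cardinality-+ k (f ∘ suc)))
  (sym (ℕₚ.+-assoc (if f zero then 1 else 0) _ _))

-- The 2n − 1 events along the path: every letter i ≠ s leaves g at height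
-- later i, and every letter leaves f at height earlier i.
module Events {n} (s : Fin (2 ℕ.+ n)) (earlier later : Fin (2 ℕ.+ n) → ℚ) where

  Event : Set
  Event = Fin (2 ℕ.* (2 ℕ.+ n) ∸ 1)

  -- `2 * (2 + n) ∸ 1` unfolds to `(1 + n) + ((2 + n) + 0)`: late events come first, then early
  -- ones, and the trailing 0 accounts for the absurd branch.
  on-events : ∀ {A : Set} → (Fin (1 ℕ.+ n) → A) → (Fin (2 ℕ.+ n) → A) → Event → A
  on-events u v k = [ u , (λ k' → [ v , (λ ()) ]′ (splitAt (2 ℕ.+ n) k')) ]′ (splitAt (1 ℕ.+ n) k)

  letter : Event → Fin (2 ℕ.+ n)
  letter = on-events (punchIn s) id

  height : Event → ℚ
  height = on-events (later ∘ punchIn s) earlier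

  earlyEvent : Fin (2 ℕ.+ n) → Event
  earlyEvent i = (1 ℕ.+ n) ↑ʳ (i ↑ˡ 0)

  lateEvent : Fin (1 ℕ.+ n) → Event
  lateEvent j = j ↑ˡ (2 ℕ.+ n ℕ.+ 0)

  on-earlyEvent : ∀ {A : Set} (u : Fin (1 ℕ.+ n) → A) (v : Fin (2 ℕ.+ n) → A) i →
    on-events u v (earlyEvent i) ≡ v i
  on-earlyEvent u v i
    rewrite Finₚ.splitAt-↑ʳ (1 ℕ.+ n) (2 ℕ.+ n ℕ.+ 0) (i ↑ˡ 0) | Finₚ.splitAt-↑ˡ (2 ℕ.+ n) i 0 = refl

  on-lateEvent : ∀ {A : Set} (u : Fin (1 ℕ.+ n) → A) (v : Fin (2 ℕ.+ n) → A) j →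
    on-events u v (lateEvent j) ≡ u j
  on-lateEvent u v j rewrite Finₚ.splitAt-↑ˡ (1 ℕ.+ n) j (2 ℕ.+ n ℕ.+ 0) = refl

  -- Each letter has exactly one early event, hence the final 1.
  letter-cardinality : ∀ i → cardinality (λ k → ⌊ letter k Fin.≟ i ⌋) ≡
    cardinality (λ j → ⌊ punchIn s j Fin.≟ i ⌋) ℕ.+ 1
  letter-cardinality i = begin
    cardinality (λ k → is-i (letter k))
      ≡⟨ cardinality-+ (1 ℕ.+ n) (λ k → is-i (letter k)) ⟩
    cardinality (λ j → is-i (letter (lateEvent j))) ℕ.+
    cardinality (λ k → is-i (letter ((1 ℕ.+ n) ↑ʳ k)))
      ≡⟨ cong₂ ℕ._+_ (cardinality-cong (λ j → cong is-i (on-lateEvent (punchIn s) id j)))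
                     (cardinality-+ (2 ℕ.+ n) (λ k → is-i (letter ((1 ℕ.+ n) ↑ʳ k)))) ⟩
    cardinality (λ j → is-i (punchIn s j)) ℕ.+
    (cardinality (λ i' → is-i (letter (earlyEvent i'))) ℕ.+ 0)
      ≡⟨ cong (cardinality (λ j → is-i (punchIn s j)) ℕ.+_) (trans (ℕₚ.+-identityʳ _)
           (trans (cardinality-cong (λ i' → cong is-i (on-earlyEvent (punchIn s) id i')))
             (cardinality-1 is-i i (⌊⌋-true (i Fin.≟ i) refl) (λ i' → ⌊⌋-true⁻ (i' Fin.≟ i))))) ⟩
    cardinality (λ j → is-i (punchIn s j)) ℕ.+ 1 ∎
    where
    open ≡-Reasoning
    is-i : Fin (2 ℕ.+ n) → Bool
    is-i j = ⌊ j Fin.≟ i ⌋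

  letter-once : cardinality (λ k → ⌊ letter k Fin.≟ s ⌋) ≡ 1
  letter-once = trans (letter-cardinality s) (cong (ℕ._+ 1)
    (cardinality-0 (λ j → ⌊ punchIn s j Fin.≟ s ⌋)
      (λ j h → Finₚ.punchInᵢ≢i s j (⌊⌋-true⁻ (punchIn s j Fin.≟ s) h))))

  letter-twice : ∀ i → i ≢ s → cardinality (λ k → ⌊ letter k Fin.≟ i ⌋) ≡ 2
  letter-twice i i≢s = trans (letter-cardinality i) (cong (ℕ._+ 1)
    (cardinality-1 (λ j → ⌊ punchIn s j Fin.≟ i ⌋) (punchOut s≢i)
      (⌊⌋-true (punchIn s (punchOut s≢i) Fin.≟ i) (Finₚ.punchIn-punchOut s≢i))
      (λ j h → Finₚ.punchIn-injective s j (punchOut s≢i)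
        (trans (⌊⌋-true⁻ (punchIn s j Fin.≟ i) h) (sym (Finₚ.punchIn-punchOut s≢i))))))
    where
    s≢i : s ≢ i
    s≢i = i≢s ∘ sym

  height-cases : ∀ k → height k ≡ earlier (letter k) ⊎ height k ≡ later (letter k)
  height-cases k with splitAt (1 ℕ.+ n) k
  ... | inj₁ j  = inj₂ refl
  ... | inj₂ k' with splitAt (2 ℕ.+ n) k'
  ...   | inj₁ i = inj₁ refl

  earlier-attained : ∀ i → ∃ λ k → letter k ≡ i × height k ≡ earlier i
  earlier-attained i = earlyEvent i , on-earlyEvent (punchIn s) id i ,
    on-earlyEvent (later ∘ punchIn s) earlier i

  -- The letter s has no late event; its early event takes over.
  later-attained : earlier s ≡ later s → ∀ i → ∃ λ k → letter k ≡ i × height k ≡ later i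
  later-attained eq i with s Fin.≟ i
  ... | yes refl = let k , lk , hk = earlier-attained s in k , lk , trans hk eq
  ... | no s≢i = lateEvent (punchOut s≢i) ,
    trans (on-lateEvent (punchIn s) id (punchOut s≢i)) (Finₚ.punchIn-punchOut s≢i) ,
    trans (on-lateEvent (later ∘ punchIn s) earlier (punchOut s≢i))
      (cong later (Finₚ.punchIn-punchOut s≢i))

-- Minimising the g-coordinate is maximising e + f, as is forced on the letter occurring once.
module Heights {n} (x : QVec (2 ℕ.+ n)) (x∈ : InDelta x)
               (s : Fin (2 ℕ.+ n)) (s-min : ∀ i → x s 2F ℚ.≤ x i 2F) where

  x≥0 : ∀ i j → 0ℚ ℚ.≤ x i j
  x≥0 = proj₁ x∈

  γ r : ℚ
  γ = x s 2F
  r = 1ℚ ℚ.- γ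

  earlier later : Fin (2 ℕ.+ n) → ℚ
  earlier i = x i 1F
  later   i = r ℚ.- x i 0F

  later-earlier : ∀ i → later i ≡ earlier i ℚ.+ (x i 2F ℚ.- γ)
  later-earlier i = trans (cong (λ t → t ℚ.- γ ℚ.- x i 0F) (sym (proj₂ x∈ i)))
    -- The constant 0 is the empty tail of `sumℚ`.
    (solve 4 (λ a b c d → (a :+ (b :+ (c :+ con 0ℚ))) :- d :- a := b :+ (c :- d)) refl
      (x i 0F) (x i 1F) (x i 2F) γ)
    where open +-*-Solver

  earlier≤later : ∀ i → earlier i ℚ.≤ later i
  earlier≤later i = subst (earlier i ℚ.≤_) (sym (later-earlier i))
    (p≤p+q (earlier i) (0≤q-p (s-min i)))

  later≤r : ∀ i → later i ℚ.≤ r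
  later≤r i = subst (later i ℚ.≤_)
    (AbelianGroupProperties.//-rightDividesˡ ℚₚ.+-0-abelianGroup (x i 0F) r)
    (p≤p+q (later i) (x≥0 i 0F))

  earlier-s : earlier s ≡ later s
  earlier-s = sym (trans (later-earlier s)
    (trans (cong (earlier s ℚ.+_) (ℚₚ.+-inverseʳ γ)) (ℚₚ.+-identityʳ (earlier s))))

  open Events s earlier later public

-- Any sorting permutation serves; ties may be broken arbitrarily.
module Cover {n} (x : QVec (2 ℕ.+ n)) (x∈ : InDelta x)
             (s : Fin (2 ℕ.+ n)) (s-min : ∀ i → x s 2F ℚ.≤ x i 2F)
             (π : Permutation′ (2 ℕ.* (2 ℕ.+ n) ∸ 1))
             (π-sorts : ∀ {i j} → i Fin.≤ j →
               Heights.height x x∈ s s-min (π ⟨$⟩ʳ i) ℚ.≤ Heights.height x x∈ s s-min (π ⟨$⟩ʳ j))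
             where

  open Heights x x∈ s s-min

  b : Word (2 ℕ.+ n)
  b k = letter (π ⟨$⟩ʳ k)

  w : Event → ℚ
  w k = height (π ⟨$⟩ʳ k)

  w-mono : ∀ {i j} → i Fin.≤ j → w i ℚ.≤ w j
  w-mono = π-sorts

  B : Biperm (2 ℕ.+ n)
  B = b , s ,
    trans (cardinality-permute (λ k → ⌊ letter k Fin.≟ s ⌋) π) letter-once ,
    (λ i i≢s → trans (cardinality-permute (λ k → ⌊ letter k Fin.≟ i ⌋) π) (letter-twice i i≢s))

  P : Positions b
  P = positions B
  open Positions P

  w≥earlier : ∀ k → earlier (b k) ℚ.≤ w k
  w≥earlier k with height-cases (π ⟨$⟩ʳ k)
  ... | inj₁ eq = ℚₚ.≤-reflexive (sym eq)
  ... | inj₂ eq = subst (earlier (b k) ℚ.≤_) (sym eq) (earlier≤later (b k))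

  w≤later : ∀ k → w k ℚ.≤ later (b k)
  w≤later k with height-cases (π ⟨$⟩ʳ k)
  ... | inj₁ eq = subst (ℚ._≤ later (b k)) (sym eq) (earlier≤later (b k))
  ... | inj₂ eq = ℚₚ.≤-reflexive eq

  attained : ∀ {i v} → (∃ λ k → letter k ≡ i × height k ≡ v) → ∃ λ k → b k ≡ i × w k ≡ v
  attained (k , lk , hk) = π ⟨$⟩ˡ k ,
    trans (cong letter (Perm.inverseʳ π)) lk , trans (cong height (Perm.inverseʳ π)) hk

  w-first≤ : ∀ {i v} → (∃ λ k → b k ≡ i × w k ≡ v) → w (first i) ℚ.≤ v
  w-first≤ (k , refl , refl) = w-mono (first-least k)

  w-last≥ : ∀ {i v} → (∃ λ k → b k ≡ i × w k ≡ v) → v ℚ.≤ w (last i)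
  w-last≥ (k , refl , refl) = w-mono (last-greatest k)

  -- Under ties the first occurrence may be a late event, so its height is squeezed: every event of
  -- i is at least `earlier i`, and an event attaining this value lies at or after `first i`.
  w-first : ∀ i → w (first i) ≡ earlier i
  w-first i = ℚₚ.≤-antisym (w-first≤ (attained (earlier-attained i)))
    (subst (λ i' → earlier i' ℚ.≤ w (first i)) (word-first i) (w≥earlier (first i)))

  w-last : ∀ i → w (last i) ≡ later i
  w-last i = ℚₚ.≤-antisym
    (subst (λ i' → w (last i) ℚ.≤ later i') (word-last i) (w≤later (last i)))
    (w-last≥ (attained (later-attained earlier-s i)))

  c : Fin (3 ℕ.+ (2 ℕ.* (2 ℕ.+ n) ∸ 2)) → ℚ
  c = ℚΣ.solution γ r w

  y : Event → ℚ
  y = ℚΣ.diff 0ℚ w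

  -- The differences telescope to the largest height, which is at most a `later` value. The slack is
  -- the weight of eⁿ.
  sum≤r : ℚΣ.sum y ℚ.≤ r
  sum≤r = subst (ℚ._≤ r) (trans
      (trans (sym (ℚΣ.prefix-diff 0ℚ w top)) (ℚₚ.+-identityˡ (ℚΣ.prefix y top)))
      (ℚΣ.prefix-last y))
    (ℚₚ.≤-trans (w≤later top) (later≤r (b top)))
    where
    top : Event
    top = fromℕ _

  c≥0 : ∀ t → 0ℚ ℚ.≤ c t
  c≥0 0F            = x≥0 s 2F
  c≥0 1F            = 0≤q-p sum≤r
  c≥0 (suc (suc m)) = diff-nonneg 0ℚ w
    (λ k → ℚₚ.≤-trans (x≥0 (b k) 1F) (w≥earlier k)) w-mono m

  c≡1 : sumℚ c ≡ 1ℚ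
  c≡1 = trans (sumℚ≡sum c) (trans
    (cong (γ ℚ.+_) (AbelianGroupProperties.//-rightDividesˡ ℚₚ.+-0-abelianGroup (ℚΣ.sum y) r))
    (trans (ℚₚ.+-comm γ r) (AbelianGroupProperties.//-rightDividesˡ ℚₚ.+-0-abelianGroup γ 1ℚ)))

  labels : ∀ t → coneSimplex ψ φ B t ≈ᶻ vert (simplexLabel first last t)
  labels = coneSimplex-label P (proj₂ B)

  x≡ : ∀ i j → x i j ≡ sumℚ (λ t → c t ℚ.* toℚ (coneSimplex ψ φ B t i j))
  x≡ i j = trans
    (sym (ℚΣ.third-determined (ℚΣ.coordinate first last c i) (x i)
      (trans (coordinate-sum P (coneSimplex ψ φ B) labels c i c≡1)
        (trans (sym (proj₂ x∈ i)) (sumℚ≡sum (x i))))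
      (ℚΣ.solution-e first last γ r w (λ i → x i 0F) earlier w-last i)
      (ℚΣ.solution-f first last γ r w (λ i → x i 0F) earlier w-first first≤last i)
      j))
    (sym (combination-coordinate P (coneSimplex ψ φ B) labels c i j))

  inConv : InConv (coneSimplex ψ φ B) x
  inConv = c , c≥0 , (λ _ _ → tt) , c≡1 , x≡

cover : ∀ {n} (x : QVec (2 ℕ.+ n)) → InDelta x →
  Σ (Biperm (2 ℕ.+ n)) λ B → InConv (coneSimplex ψ φ B) x
cover x x∈ =
  let s , s-min     = argmin (λ i → x i 2F)
      π , π-sorts   = sort (Heights.height x x∈ s s-min)
  in Cover.B x x∈ s s-min π π-sorts , Cover.inConv x x∈ s s-min π π-sorts

theorem5p1 : (n : ℕ) → 2 ≤ n →
    Σ (Fin 3 → ZVec n) λ ψ → Σ (Biperm n → Fin (2 Data.Nat.* n Data.Nat.∸ 2) → ZVec n) λ φ →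
    IsVertexEmbedding ψ φ × IsUnimodularTriangulation (Biperm n) (coneSimplex ψ φ)
theorem5p1 (suc (suc n)) (s≤s (s≤s z≤n)) = ψ , φ , vertexEmbedding ,
  (λ B → inConv⇒inDelta (positions B) (coneSimplex ψ φ B) (labels B)) ,
  cover ,
  (λ B B' → inConv-common (positions B) (positions B')
    (coneSimplex ψ φ B) (coneSimplex ψ φ B') (labels B) (labels B')) ,
  (λ B → unimodular (positions B) (coneSimplex ψ φ B) (labels B))
  where
  labels : ∀ (B : Biperm (2 ℕ.+ n)) t → coneSimplex ψ φ B t ≈ᶻ
    vert (simplexLabel (Positions.first (positions B)) (Positions.last (positions B)) t)
  labels B = coneSimplex-label (positions B) (proj₂ B)
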